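{- For all integers $n,k$ with $n\ge k\ge 2$, \[ m(n,k)\ge \frac{n(n-1)}{k(k-1)}. \]
   Context: A hypergraph is an ordered pair $(X,H)$ such that $X$ is a set and $H$ is a family of subsets of $X$; elements of $X$ are its vertices and members of $H$ are its edges (edges may have arbitrary sizes). For any two distinct vertices $u,v$ of a hypergraph $(X,H)$, the line $\overline{uv}$ is the set $\{u,v\}\cup\{p\in X:\ \exists\, T\in H \text{ with } \{u,v,p\}\subseteq T\}$. The lines of the hypergraph are all the sets $\overline{uv}$ with $u,v$ distinct vertices; the number of lines is the number of distinct such sets. For integers $n,k$, $m(n,k)$ denotes the smallest number of (distinct) lines in a hypergraph on $n$ vertices where every line consists of at most $k$ vertices. -}

module Defs where

import Data.Bool.Properties as Bool
open import Data.Empty using (⊥; ⊥-elim)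
open import Data.Fin.Base using (Fin)
import Data.Fin.Properties as Fin
open import Data.Fin.Subset using (Subset; inside; outside; ⁅_⁆; _∪_; _∈_; _⊆_; ∣_∣)
open import Data.Fin.Subset.Properties
  using (_⊆?_; anySubset?; ∣⁅x⁆∣≡1; p⊆q⇒∣p∣≤∣q∣; x∈p∪q⁻)
open import Data.List.Base
  using (List; []; _∷_; [_]; map; _++_; filter; length; deduplicate; allFin; cartesianProduct)
open import Data.List.Extrema.Nat using (argmin; argmin-all; f[argmin]≤v⁺)
open import Data.List.Membership.Propositional using (lose) renaming (_∈_ to _∈ˡ_)
open import Data.List.Membership.Propositional.Properties
  using (∈-++⁺ˡ; ∈-++⁺ʳ; ∈-map⁺; ∈-filter⁺; ∈-filter⁻)
import Data.List.Membership.DecPropositional as DecMembership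
open import Data.List.Properties using (map-cong)
open import Data.List.Relation.Unary.All.Properties using (all-filter)
open import Data.List.Relation.Unary.Any using (here)
open import Data.Nat.Base using (ℕ; zero; suc; _+_; _*_; _∸_; _≤_; s≤s; NonZero)
open import Data.Nat.Properties
  using (≤-refl; ≤-trans; ≤-reflexive; m≤n⇒m≤1+n; +-suc; _≤?_)
open import Data.Product.Base using (_×_; _,_; ∃; proj₁; proj₂; uncurry; map₁; map₂)
open import Data.Sum.Base using (inj₁; inj₂)
open import Data.Vec.Base using ([]; _∷_; tabulate)
open import Data.Vec.Properties using (≡-dec; tabulate-cong; lookup∘tabulate; []=⇒lookup)
open import Function.Base using (_∘_)
open import Function.Bundles using (mk⇔)
open import Level using (Level; 0ℓ)
open import Relation.Binary.Definitions using (DecidableEquality)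
open import Relation.Binary.PropositionalEquality
  using (_≡_; _≢_; refl; sym; trans; cong; subst)
open import Relation.Nullary.Decidable
  using (yes; no; does; does-⇔; _×-dec_; _→-dec_; ¬?)
open import Relation.Unary using (Pred; Decidable)

private
  variable
    a p : Level
    A : Set a
    n k : ℕ

-- The vertex set is Fin n.  Decidability of the edge family is what makes lines
-- and the number of lines computable; classically it is no restriction.
record Hypergraph (n : ℕ) : Set₁ where
  field
    Edge  : Pred (Subset n) 0ℓ
    edge? : Decidable Edge

open Hypergraph public

⟪_⟫ : {P : Pred (Fin n) p} → Decidable P → Subset n
⟪ P? ⟫ = tabulate (does ∘ P?)

InCommonEdge : Hypergraph n → (u v p : Fin n) → Set
InCommonEdge H u v p = ∃ λ T → Edge H T × (⁅ u ⁆ ∪ ⁅ v ⁆ ∪ ⁅ p ⁆) ⊆ T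

inCommonEdge? : (H : Hypergraph n) (u v : Fin n) → Decidable (InCommonEdge H u v)
inCommonEdge? H u v p =
  anySubset? (λ T → edge? H T ×-dec ((⁅ u ⁆ ∪ ⁅ v ⁆ ∪ ⁅ p ⁆) ⊆? T))

line : Hypergraph n → Fin n → Fin n → Subset n
line H u v = (⁅ u ⁆ ∪ ⁅ v ⁆) ∪ ⟪ inCommonEdge? H u v ⟫

_≟ˢ_ : DecidableEquality (Subset n)
_≟ˢ_ = ≡-dec Bool._≟_

distinctPairs : ∀ n → List (Fin n × Fin n)
distinctPairs n =
  filter (λ (u , v) → ¬? (u Fin.≟ v)) (cartesianProduct (allFin n) (allFin n))

lines : Hypergraph n → List (Subset n)
lines {n} H = deduplicate _≟ˢ_ (map (uncurry (line H)) (distinctPairs n))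

numLines : Hypergraph n → ℕ
numLines H = length (lines H)

LinesAtMost : ℕ → Hypergraph n → Set
LinesAtMost k H = ∀ u v → u ≢ v → ∣ line H u v ∣ ≤ k

IsLeast : Pred ℕ p → Pred ℕ p
IsLeast P l = P l × (∀ {j} → P j → l ≤ j)

IsLineCount : ℕ → ℕ → ℕ → Set₁
IsLineCount n k l = ∃ λ (H : Hypergraph n) → LinesAtMost k H × numLines H ≡ l

private

  linesAtMost? : ∀ k → Decidable (LinesAtMost {n} k)
  linesAtMost? k H =
    Fin.all? λ u → Fin.all? λ v → ¬? (u Fin.≟ v) →-dec (∣ line H u v ∣ ≤? k)

  -- The edgeless hypergraph, whose lines are the sets {u,v}.

  edgeless : Hypergraph n
  edgeless .Edge  _ = ⊥
  edgeless .edge? _ = no λ ()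

  ∣p∪q∣≤∣p∣+∣q∣ : (p q : Subset n) → ∣ p ∪ q ∣ ≤ ∣ p ∣ + ∣ q ∣
  ∣p∪q∣≤∣p∣+∣q∣ []            []            = ≤-refl
  ∣p∪q∣≤∣p∣+∣q∣ (outside ∷ p) (outside ∷ q) = ∣p∪q∣≤∣p∣+∣q∣ p q
  ∣p∪q∣≤∣p∣+∣q∣ (outside ∷ p) (inside  ∷ q) =
    ≤-trans (s≤s (∣p∪q∣≤∣p∣+∣q∣ p q)) (≤-reflexive (sym (+-suc ∣ p ∣ ∣ q ∣)))
  ∣p∪q∣≤∣p∣+∣q∣ (inside  ∷ p) (outside ∷ q) = s≤s (∣p∪q∣≤∣p∣+∣q∣ p q)
  ∣p∪q∣≤∣p∣+∣q∣ (inside  ∷ p) (inside  ∷ q) =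
    s≤s (≤-trans (∣p∪q∣≤∣p∣+∣q∣ p q)
      (≤-trans (m≤n⇒m≤1+n ≤-refl) (≤-reflexive (sym (+-suc ∣ p ∣ ∣ q ∣)))))

  ∈⟪⟫⁻ : {P : Pred (Fin n) p} (P? : Decidable P) {i : Fin n} → i ∈ ⟪ P? ⟫ → P i
  ∈⟪⟫⁻ P? {i} i∈ with P? i | trans (sym (lookup∘tabulate (does ∘ P?) i)) ([]=⇒lookup i∈)
  ... | yes Pi | _  = Pi
  ... | no  _  | ()

  edgeless-linesAtMost : 2 ≤ k → LinesAtMost {n} k edgeless
  edgeless-linesAtMost {k = k} 2≤k u v _ = ≤-trans (p⊆q⇒∣p∣≤∣q∣ line⊆) (≤-trans
    (∣p∪q∣≤∣p∣+∣q∣ ⁅ u ⁆ ⁅ v ⁆)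
    (subst (_≤ k) (sym ∣⁅u⁆∣+∣⁅v⁆∣≡2) 2≤k))
    where
    ∣⁅u⁆∣+∣⁅v⁆∣≡2 : ∣ ⁅ u ⁆ ∣ + ∣ ⁅ v ⁆ ∣ ≡ 2
    ∣⁅u⁆∣+∣⁅v⁆∣≡2 rewrite ∣⁅x⁆∣≡1 u | ∣⁅x⁆∣≡1 v = refl
    line⊆ : line edgeless u v ⊆ (⁅ u ⁆ ∪ ⁅ v ⁆)
    line⊆ x∈ with x∈p∪q⁻ (⁅ u ⁆ ∪ ⁅ v ⁆) _ x∈
    ... | inj₁ x∈uv = x∈uv
    ... | inj₂ x∈T  = ⊥-elim (proj₁ (proj₂ (∈⟪⟫⁻ (inCommonEdge? edgeless u v) x∈T)))

  -- Up to having the same edges, there are finitely many hypergraphs on Fin n.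

  subsets : ∀ n → List (Subset n)
  subsets zero    = [ [] ]
  subsets (suc n) = map (inside ∷_) (subsets n) ++ map (outside ∷_) (subsets n)

  ∈-subsets : (T : Subset n) → T ∈ˡ subsets n
  ∈-subsets []            = here refl
  ∈-subsets (inside  ∷ T) = ∈-++⁺ˡ (∈-map⁺ (inside ∷_) (∈-subsets T))
  ∈-subsets (outside ∷ T) = ∈-++⁺ʳ _ (∈-map⁺ (outside ∷_) (∈-subsets T))

  sublists : List A → List (List A)
  sublists []       = [ [] ]
  sublists (x ∷ xs) = map (x ∷_) (sublists xs) ++ sublists xs

  filter∈sublists : {P : Pred A p} (P? : Decidable P) (xs : List A) →
                    filter P? xs ∈ˡ sublists xs
  filter∈sublists P? []       = here refl
  filter∈sublists P? (x ∷ xs) with P? x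
  ... | yes _ = ∈-++⁺ˡ (∈-map⁺ (x ∷_) (filter∈sublists P? xs))
  ... | no  _ = ∈-++⁺ʳ _ (filter∈sublists P? xs)

  fromList : List (Subset n) → Hypergraph n
  fromList Ts .Edge  T = T ∈ˡ Ts
  fromList Ts .edge? T = T ∈? Ts
    where open DecMembership _≟ˢ_ using (_∈?_)

  hypergraphs : ∀ n → List (Hypergraph n)
  hypergraphs n = map fromList (sublists (subsets n))

  enumerated : Hypergraph n → Hypergraph n
  enumerated {n} H = fromList (filter (edge? H) (subsets n))

  enumerated∈hypergraphs : (H : Hypergraph n) → enumerated H ∈ˡ hypergraphs n
  enumerated∈hypergraphs {n} H = ∈-map⁺ fromList (filter∈sublists (edge? H) (subsets n))

  line-enumerated : (H : Hypergraph n) (u v : Fin n) → line (enumerated H) u v ≡ line H u v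
  line-enumerated {n} H u v = cong ((⁅ u ⁆ ∪ ⁅ v ⁆) ∪_) (tabulate-cong λ p →
    does-⇔ (mk⇔ (map₂ (map₁ (λ T∈ → proj₂ (∈-filter⁻ (edge? H) {xs = subsets n} T∈))))
                (map₂ (map₁ (λ HT → ∈-filter⁺ (edge? H) (∈-subsets _) HT))))
           (inCommonEdge? (enumerated H) u v p) (inCommonEdge? H u v p))

  numLines-enumerated : (H : Hypergraph n) → numLines (enumerated H) ≡ numLines H
  numLines-enumerated {n} H = cong (length ∘ deduplicate _≟ˢ_)
    (map-cong (λ (u , v) → line-enumerated H u v) (distinctPairs n))

  linesAtMost-enumerated : (H : Hypergraph n) → LinesAtMost k H → LinesAtMost k (enumerated H)
  linesAtMost-enumerated H H≤k u v u≢v =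
    subst (λ L → ∣ L ∣ ≤ _) (sym (line-enumerated H u v)) (H≤k u v u≢v)

leastLineCount : ∀ n k → 2 ≤ k → ∃ (IsLeast (IsLineCount n k))
leastLineCount n k 2≤k =
  numLines best ,
  (best ,
   argmin-all numLines (edgeless-linesAtMost 2≤k) (all-filter (linesAtMost? k) (hypergraphs n)) ,
   refl) ,
  minimal
  where
  candidates : List (Hypergraph n)
  candidates = filter (linesAtMost? k) (hypergraphs n)

  best : Hypergraph n
  best = argmin numLines edgeless candidates

  minimal : ∀ {j} → IsLineCount n k j → numLines best ≤ j
  minimal (H , H≤k , refl) = f[argmin]≤v⁺ {f = numLines} edgeless candidates (inj₂ (lose
    (∈-filter⁺ (linesAtMost? k) (enumerated∈hypergraphs H) (linesAtMost-enumerated H H≤k))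
    (≤-reflexive (numLines-enumerated H))))

-- For k < 2 and n ≥ 2 no hypergraph qualifies, so m is only defined for k ≥ 2.
m : (n k : ℕ) → 2 ≤ k → ℕ
m n k 2≤k = proj₁ (leastLineCount n k 2≤k)

k*[k∸1]-nonZero : 2 ≤ k → NonZero (k * (k ∸ 1))
k*[k∸1]-nonZero (s≤s (s≤s _)) = _

{-# OPTIONS --safe #-}

-- Double counting.  A pair of distinct vertices lies on the line it generates,
-- so the n(n−1) ordered pairs of distinct vertices are covered by the pairs of
-- distinct points of the various lines, and a line of at most k points has at
-- most k(k−1) of these.

module Submission where

open import Defs
open import Data.Nat.Base using (ℕ; _*_; _∸_; _≤_)
open import Data.Integer.Base using (+_)
open import Data.Rational.Base using (_/_; _≥_)

open import Data.Bool.Base using (true; false)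
open import Data.Fin.Base using (Fin; zero; suc)
import Data.Fin.Properties as Fin
open import Data.Fin.Subset using (Subset; inside; outside; ⁅_⁆; _∪_; _∈_; ∣_∣)
open import Data.Fin.Subset.Properties using (x∈p∪q⁺; x∈⁅x⁆)
import Data.Integer.Base as ℤ
import Data.Integer.Properties as ℤ
open import Data.List.Base
  using (List; []; _∷_; map; _++_; filter; length; concatMap; cartesianProduct; allFin)
open import Data.List.Membership.Propositional using (lose) renaming (_∈_ to _∈ˡ_)
open import Data.List.Membership.Propositional.Properties
  using ( ∈-map⁺; ∈-filter⁺; ∈-filter⁻; ∈-cartesianProduct⁺; ∈-concatMap⁺
        ; ∈-deduplicate⁺; ∈-deduplicate⁻; ∈-map⁻; ∈-length)
open import Data.List.Properties
  using ( length-map; length-++; length-tabulate; filter-notAll; filter-++; filter-all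
        ; filter-accept; filter-reject)
open import Data.List.Relation.Binary.Subset.Propositional using () renaming (_⊆_ to _⊆ˡ_)
import Data.List.Relation.Unary.All as All
open import Data.List.Relation.Unary.All using (All; []; _∷_)
open import Data.List.Relation.Unary.All.Properties using () renaming (map⁺ to All-map⁺)
open import Data.List.Relation.Unary.Any using (here; there)
open import Data.List.Relation.Unary.AllPairs using ([]; _∷_)
open import Data.List.Relation.Unary.Unique.Propositional using (Unique)
import Data.List.Relation.Unary.Unique.Propositional.Properties as Unique
open import Data.Nat.Base using (suc; _+_; z≤n; s≤s; NonZero; >-nonZero)
open import Data.Nat.Properties
  using ( ≤-trans; +-mono-≤; *-mono-≤; ∸-monoˡ-≤; suc-pred
        ; module ≤-Reasoning)
open import Data.Product.Base using (_×_; _,_; proj₁; proj₂; uncurry)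
open import Data.Product.Properties using (≡-dec)
import Data.Rational.Base as ℚ
import Data.Rational.Properties as ℚ
import Data.Rational.Unnormalised.Base as ℚᵘ
import Data.Rational.Unnormalised.Properties as ℚᵘ
open import Data.Sum.Base using (inj₁; inj₂)
open import Data.Vec.Base using ([]; _∷_; here; there)
open import Function.Base using (_∘_; id)
open import Level using (Level)
open import Relation.Binary.Definitions using (DecidableEquality)
open import Relation.Binary.PropositionalEquality
  using (_≡_; _≢_; refl; sym; trans; cong; cong₂; subst; subst₂; module ≡-Reasoning)
open import Relation.Nullary.Decidable using (¬?; does)
open import Relation.Unary using (Pred; Decidable)

private
  variable
    a b p : Level
    A : Set a
    B : Set b
    n : ℕ

filter-map : {P : Pred B p} (P? : Decidable P) (f : A → B) (xs : List A) →
             filter P? (map f xs) ≡ map f (filter (P? ∘ f) xs)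
filter-map P? f []       = refl
filter-map P? f (x ∷ xs) with does (P? (f x))
... | true  = cong (f x ∷_) (filter-map P? f xs)
... | false = filter-map P? f xs

-- The upper half of the double count: with `f` listing the pairs on a line, each line contributes
-- at most `c` of them.
length-concatMap-≤ : (f : A → List B) {c : ℕ} {xs : List A} →
                     All (λ x → length (f x) ≤ c) xs →
                     length (concatMap f xs) ≤ length xs * c
length-concatMap-≤ f []                      = z≤n
length-concatMap-≤ f {c} {x ∷ xs} (fx≤ ∷ fxs≤) = begin
  length (f x ++ concatMap f xs)          ≡⟨ length-++ (f x) ⟩
  length (f x) + length (concatMap f xs)  ≤⟨ +-mono-≤ fx≤ (length-concatMap-≤ f fxs≤) ⟩
  c + length xs * c                       ∎
  where open ≤-Reasoning

module _ {A : Set a} (_≟_ : DecidableEquality A) where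

  -- Pigeonhole by induction: delete the head `x` of `xs` from `ys`. The tail avoids `x`, so it
  -- stays included, and `ys` gets strictly shorter because it contained `x`.
  Unique-⊆⇒length-≤ : {xs ys : List A} → Unique xs → xs ⊆ˡ ys → length xs ≤ length ys
  Unique-⊆⇒length-≤ []                                  _     = z≤n
  Unique-⊆⇒length-≤ {x ∷ xs} {ys} (x∉xs ∷ xs!) xs⊆ys = ≤-trans
    (s≤s (Unique-⊆⇒length-≤ xs! λ z∈xs →
      ∈-filter⁺ ≢x? (xs⊆ys (there z∈xs)) (All.lookup x∉xs z∈xs)))
    (filter-notAll ≢x? ys (lose (xs⊆ys (here refl)) (λ x≢x → x≢x refl)))
    where
    ≢x? = λ y → ¬? (x ≟ y)

  length-filter-≢ : {x : A} {xs : List A} → Unique xs → x ∈ˡ xs →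
                    length (filter (λ y → ¬? (x ≟ y)) xs) ≡ length xs ∸ 1
  length-filter-≢ {x} (x∉xs ∷ _) (here refl) = cong length (trans
    (filter-reject (λ y → ¬? (x ≟ y)) (λ x≢x → x≢x refl))
    (filter-all (λ y → ¬? (x ≟ y)) x∉xs))
  length-filter-≢ {x} {_ ∷ xs} (y∉xs ∷ xs!) (there x∈xs) = begin
    length (filter ≢x? (_ ∷ xs))   ≡⟨ cong length (filter-accept ≢x? (All.lookup y∉xs x∈xs ∘ sym)) ⟩
    suc (length (filter ≢x? xs))   ≡⟨ cong suc (length-filter-≢ xs! x∈xs) ⟩
    -- Since `x` lies in `xs`, this length is positive and the truncated subtraction is exact.
    suc (length xs ∸ 1)            ≡⟨ suc-pred (length xs) {{>-nonZero (∈-length x∈xs)}} ⟩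
    length xs                      ∎
    where
    open ≡-Reasoning
    ≢x? = λ y → ¬? (x ≟ y)

  -- Two arguments let an induction shorten the first list while the second stays whole; the
  -- applications below take both equal.
  offDiagonal : List A → List A → List (A × A)
  offDiagonal xs ys = filter (λ (x , y) → ¬? (x ≟ y)) (cartesianProduct xs ys)

  -- Each entry of `xs` occurs exactly once in `ys`, so its row of the product loses exactly one
  -- pair.
  length-offDiagonal : {xs ys : List A} → xs ⊆ˡ ys → Unique ys →
                       length (offDiagonal xs ys) ≡ length xs * (length ys ∸ 1)
  length-offDiagonal {[]}          _     _   = refl
  length-offDiagonal {x ∷ xs} {ys} xs⊆ys ys! = begin
    length (filter D? (map (x ,_) ys ++ cartesianProduct xs ys))
      ≡⟨ cong length (filter-++ D? (map (x ,_) ys) _) ⟩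
    length (filter D? (map (x ,_) ys) ++ offDiagonal xs ys)
      ≡⟨ length-++ (filter D? (map (x ,_) ys)) ⟩
    length (filter D? (map (x ,_) ys)) + length (offDiagonal xs ys)
      -- Within the row of `x`, dropping the diagonal amounts to deleting `x` from `ys`.
      ≡⟨ cong (λ zs → length zs + length (offDiagonal xs ys)) (filter-map D? (x ,_) ys) ⟩
    length (map (x ,_) (filter (D? ∘ (x ,_)) ys)) + length (offDiagonal xs ys)
      ≡⟨ cong₂ _+_ (trans (length-map (x ,_) (filter (D? ∘ (x ,_)) ys))
                          (length-filter-≢ ys! (xs⊆ys (here refl))))
                   (length-offDiagonal (xs⊆ys ∘ there) ys!) ⟩
    (length ys ∸ 1) + length xs * (length ys ∸ 1) ∎
    where
    open ≡-Reasoning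
    D? = λ ((x , y) : A × A) → ¬? (x ≟ y)

-- Turns a line into a duplicate-free list, so that the list counts above apply to it.
elements : Subset n → List (Fin n)
elements []            = []
elements (inside  ∷ p) = zero ∷ map suc (elements p)
elements (outside ∷ p) = map suc (elements p)

∈-elements : {p : Subset n} {x : Fin n} → x ∈ p → x ∈ˡ elements p
∈-elements                      here        = here refl
∈-elements {p = inside  ∷ _} (there x∈p) = there (∈-map⁺ suc (∈-elements x∈p))
∈-elements {p = outside ∷ _} (there x∈p) = ∈-map⁺ suc (∈-elements x∈p)

elements-Unique : (p : Subset n) → Unique (elements p)
elements-Unique []            = []
elements-Unique (inside  ∷ p) =
  All-map⁺ (All.universal (λ _ ()) (elements p)) ∷ Unique.map⁺ Fin.suc-injective (elements-Unique p)
elements-Unique (outside ∷ p) = Unique.map⁺ Fin.suc-injective (elements-Unique p)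

length-elements : (p : Subset n) → length (elements p) ≡ ∣ p ∣
length-elements []            = refl
length-elements (inside  ∷ p) = cong suc (trans (length-map suc (elements p)) (length-elements p))
length-elements (outside ∷ p) = trans (length-map suc (elements p)) (length-elements p)

distinctPairsIn : Subset n → List (Fin n × Fin n)
distinctPairsIn p = offDiagonal Fin._≟_ (elements p) (elements p)

length-distinctPairsIn : (p : Subset n) → length (distinctPairsIn p) ≡ ∣ p ∣ * (∣ p ∣ ∸ 1)
length-distinctPairsIn p = trans
  (length-offDiagonal Fin._≟_ id (elements-Unique p))
  (cong (λ l → l * (l ∸ 1)) (length-elements p))

length-distinctPairs : ∀ n → length (distinctPairs n) ≡ n * (n ∸ 1)
length-distinctPairs n = trans
  (length-offDiagonal Fin._≟_ id (Unique.allFin⁺ n))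
  (cong (λ l → l * (l ∸ 1)) (length-tabulate {n = n} id))

distinctPairs-Unique : ∀ n → Unique (distinctPairs n)
distinctPairs-Unique n =
  Unique.filter⁺ _ (Unique.cartesianProduct⁺ (Unique.allFin⁺ n) (Unique.allFin⁺ n))

distinctPairs⇒≢ : {u v : Fin n} → (u , v) ∈ˡ distinctPairs n → u ≢ v
distinctPairs⇒≢ {n} uv∈ =
  proj₂ (∈-filter⁻ (λ (u , v) → ¬? (u Fin.≟ v)) {xs = cartesianProduct (allFin n) (allFin n)} uv∈)

module _ (H : Hypergraph n) where

  u∈line : ∀ u v → u ∈ line H u v
  u∈line u v = x∈p∪q⁺ (inj₁ (x∈p∪q⁺ (inj₁ (x∈⁅x⁆ u))))

  v∈line : ∀ u v → v ∈ line H u v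
  v∈line u v = x∈p∪q⁺ (inj₁ (x∈p∪q⁺ {p = ⁅ u ⁆} (inj₂ (x∈⁅x⁆ v))))

  -- The line generated by `u` and `v` is the witness: it contains both points, and deduplication
  -- keeps a copy of it.
  distinctPairs⊆ : distinctPairs n ⊆ˡ concatMap distinctPairsIn (lines H)
  distinctPairs⊆ {u , v} uv∈ = ∈-concatMap⁺ distinctPairsIn (lose
    (∈-deduplicate⁺ _≟ˢ_ (∈-map⁺ (uncurry (line H)) uv∈))
    (∈-filter⁺ (λ (u , v) → ¬? (u Fin.≟ v))
      (∈-cartesianProduct⁺ (∈-elements (u∈line u v)) (∈-elements (v∈line u v)))
      (distinctPairs⇒≢ uv∈)))

  lines-∣∣≤ : ∀ {k} → LinesAtMost k H → ∀ {L} → L ∈ˡ lines H → ∣ L ∣ ≤ k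
  lines-∣∣≤ H≤k L∈ with ∈-map⁻ (uncurry (line H)) (∈-deduplicate⁻ _≟ˢ_ _ L∈)
  ... | (u , v) , uv∈ , refl = H≤k u v (distinctPairs⇒≢ uv∈)

  n*[n∸1]≤numLines*k*[k∸1] : ∀ {k} → LinesAtMost k H → n * (n ∸ 1) ≤ numLines H * (k * (k ∸ 1))
  n*[n∸1]≤numLines*k*[k∸1] {k} H≤k = begin
    n * (n ∸ 1)                                      ≡⟨ length-distinctPairs n ⟨
    -- An inequality, since a pair lying on several lines is repeated on the right.
    length (distinctPairs n)                         ≤⟨ Unique-⊆⇒length-≤ (≡-dec Fin._≟_ Fin._≟_)
                                                          (distinctPairs-Unique n) distinctPairs⊆ ⟩
    length (concatMap distinctPairsIn (lines H))     ≤⟨ length-concatMap-≤ distinctPairsIn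
                                                          (All.tabulate distinctPairsIn≤) ⟩
    numLines H * (k * (k ∸ 1))                       ∎
    where
    open ≤-Reasoning
    distinctPairsIn≤ : ∀ {L} → L ∈ˡ lines H → length (distinctPairsIn L) ≤ k * (k ∸ 1)
    distinctPairsIn≤ {L} L∈ = subst (_≤ k * (k ∸ 1)) (sym (length-distinctPairsIn L))
      -- Truncated subtraction is monotone, so `l * (l ∸ 1)` grows with `l`.
      (*-mono-≤ (lines-∣∣≤ H≤k L∈) (∸-monoˡ-≤ 1 (lines-∣∣≤ H≤k L∈)))

n*[n∸1]≤lineCount*k*[k∸1] : ∀ {k l} → IsLineCount n k l → n * (n ∸ 1) ≤ l * (k * (k ∸ 1))
n*[n∸1]≤lineCount*k*[k∸1] (H , H≤k , refl) = n*[n∸1]≤numLines*k*[k∸1] H H≤k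

-- `toℚᵘ` reflects the order and undoes `fromℚᵘ` up to equivalence of fractions.
fromℚᵘ-mono-≤ : ∀ {p q} → p ℚᵘ.≤ q → ℚ.fromℚᵘ p ℚ.≤ ℚ.fromℚᵘ q
fromℚᵘ-mono-≤ {p} {q} p≤q = ℚ.toℚᵘ-cancel-≤ (begin
  ℚ.toℚᵘ (ℚ.fromℚᵘ p)  ≃⟨ ℚ.toℚᵘ-fromℚᵘ p ⟩
  p                    ≤⟨ p≤q ⟩
  q                    ≃⟨ ℚ.toℚᵘ-fromℚᵘ q ⟨
  ℚ.toℚᵘ (ℚ.fromℚᵘ q)  ∎)
  where open ℚᵘ.≤-Reasoning

-- Cross-multiplication, carried out on unnormalised fractions, whose numerators and denominators
-- are not reduced by a gcd.
m≤o*n⇒m/n≤o : ∀ m n o .{{_ : NonZero n}} → m ≤ o * n → + m / n ℚ.≤ + o / 1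
-- `mkℚᵘ` stores the denominator minus one, so `0` encodes the denominator 1.
m≤o*n⇒m/n≤o m (suc n-1) o m≤o*n = fromℚᵘ-mono-≤ {ℚᵘ.mkℚᵘ (+ m) n-1} {ℚᵘ.mkℚᵘ (+ o) 0}
  (ℚᵘ.*≤* (subst₂ ℤ._≤_ (sym (ℤ.*-identityʳ (+ m))) (ℤ.pos-* o (suc n-1)) (ℤ.+≤+ m≤o*n)))

theorem5 : (n k : ℕ) → k ≤ n → (2≤k : 2 ≤ k) →
    + m n k 2≤k / 1 ≥ _/_ (+ (n * (n ∸ 1))) (k * (k ∸ 1)) {{k*[k∸1]-nonZero 2≤k}}
theorem5 n k _ 2≤k =
  m≤o*n⇒m/n≤o (n * (n ∸ 1)) (k * (k ∸ 1)) (m n k 2≤k) {{k*[k∸1]-nonZero 2≤k}}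
    -- The minimum is attained: this component is a hypergraph with exactly `m n k 2≤k` lines, to
    -- which the count applies.
    (n*[n∸1]≤lineCount*k*[k∸1] (proj₁ (proj₂ (leastLineCount n k 2≤k))))
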